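{- Let $(A,W)$ be a $T_1$ Pratt comonoid such that $W$ is the least Pratt comonoid structure on $A$ containing $S$, where $S$ is a countably infinite family of subsets of $A$ which satisfy no nontrivial distributive lattice relations (i.e., $S$ is a set of free generators of a free distributive lattice under union and intersection). Then $W$ has cardinality at least $2^{\aleph_0}$, and in fact $W$ contains a complete sublattice isomorphic to the lattice of all subsets of $\omega$.
   Context: A Pratt comonoid is a pair $(A,W)$ with $A$ a set and $W$ a set of subsets of $A$ such that (i) $\emptyset\in W$ and $A\in W$; (ii) whenever $C\subseteq A\times A$ is such that for every $a\in A$ both the row $\{b\mid (a,b)\in C\}$ and the column $\{b\mid (b,a)\in C\}$ belong to $W$, the diagonal $\{b\mid (b,b)\in C\}$ also belongs to $W$. A set $W$ of subsets of $A$ satisfying these is called a Pratt comonoid structure on $A$; any intersection of such structures is again one, so there is a least one containing a given family. $(A,W)$ is $T_1$ if for all distinct $a,b\in A$ there is $w\in W$ with $a\in w$, $b\notin w$. A complete sublattice of $W$ means a subset of $W$ closed under arbitrary (possibly infinite) unions and intersections taken in the power set of $A$ (not necessarily containing $\emptyset$ or $A$). -}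

module Defs where

open import Level using (Level; 0ℓ)
open import Data.Nat using (ℕ)
open import Data.Bool using (Bool)
open import Data.Product using (Σ; ∃; _×_; _,_)
open import Relation.Nullary using (¬_)
open import Relation.Binary.PropositionalEquality using (_≡_)

Subset : Set → Set₁
Subset A = A → Set

Family : Set → Set₁
Family A = Subset A → Set

module _ {A : Set} where

  _⊆_ : Subset A → Subset A → Set
  u ⊆ v = ∀ a → u a → v a

  _≐_ : Subset A → Subset A → Set
  u ≐ v = (u ⊆ v) × (v ⊆ u)

  ∅ : Subset A
  ∅ _ = Data.Empty.⊥ where import Data.Empty

  Full : Subset A
  Full _ = Data.Unit.⊤ where import Data.Unit

  -- membership in a family of subsets is extensional (W is a *set* of subsets)
  Extensional : Family A → Set₁
  Extensional W = ∀ u v → u ≐ v → W u → W v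

  record IsPrattComonoid (W : Family A) : Set₁ where
    field
      extensional : Extensional W
      empty∈ : W ∅
      full∈  : W Full
      diagonal : (C : A → A → Set) →
                 (∀ a → W (λ b → C a b)) →
                 (∀ a → W (λ b → C b a)) →
                 W (λ b → C b b)

  record IsLeastPrattContaining (W : Family A) (S : Subset A → Set) : Set₂ where
    field
      isPratt  : IsPrattComonoid W
      contains : ∀ u → S u → W u
      least    : (W' : Family A) → IsPrattComonoid W' →
                 (∀ u → S u → W' u) → ∀ u → W u → W' u

  IsT₁ : Family A → Set₁
  IsT₁ W = ∀ a b → ¬ (a ≡ b) → Σ (Subset A) λ w → W w × w a × ¬ (w b)

data Term : Set where
  var  : ℕ → Term
  _∨_  : Term → Term → Term
  _∧_  : Term → Term → Term

infixr 6 _∧_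
infixr 5 _∨_

-- The equational theory of distributive lattices: t ≈ u iff the identity
-- t = u holds in the free distributive lattice on ℕ.
infix 4 _≈_
data _≈_ : Term → Term → Set where
  refl  : ∀ {t} → t ≈ t
  sym   : ∀ {t u} → t ≈ u → u ≈ t
  trans : ∀ {t u v} → t ≈ u → u ≈ v → t ≈ v
  ∨-cong : ∀ {t t' u u'} → t ≈ t' → u ≈ u' → (t ∨ u) ≈ (t' ∨ u')
  ∧-cong : ∀ {t t' u u'} → t ≈ t' → u ≈ u' → (t ∧ u) ≈ (t' ∧ u')
  ∨-assoc : ∀ t u v → ((t ∨ u) ∨ v) ≈ (t ∨ (u ∨ v))
  ∧-assoc : ∀ t u v → ((t ∧ u) ∧ v) ≈ (t ∧ (u ∧ v))
  ∨-comm : ∀ t u → (t ∨ u) ≈ (u ∨ t)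
  ∧-comm : ∀ t u → (t ∧ u) ≈ (u ∧ t)
  ∨-absorbs-∧ : ∀ t u → (t ∨ (t ∧ u)) ≈ t
  ∧-absorbs-∨ : ∀ t u → (t ∧ (t ∨ u)) ≈ t
  ∧-distrib-∨ : ∀ t u v → (t ∧ (u ∨ v)) ≈ ((t ∧ u) ∨ (t ∧ v))

⟦_⟧ : ∀ {A : Set} → Term → (ℕ → Subset A) → Subset A
⟦ var i ⟧ s = s i
⟦ t ∨ u ⟧ s = λ a → Data.Sum._⊎_ (⟦ t ⟧ s a) (⟦ u ⟧ s a) where import Data.Sum
⟦ t ∧ u ⟧ s = λ a → ⟦ t ⟧ s a × ⟦ u ⟧ s a

FreeGenerators : ∀ {A : Set} → (ℕ → Subset A) → Set
FreeGenerators s = ∀ t u → ⟦ t ⟧ s ≐ ⟦ u ⟧ s → t ≈ u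

Range : ∀ {A : Set} → (ℕ → Subset A) → Subset A → Set
Range {A} s u = Σ ℕ λ i → s i ≐ u

⋃ : ∀ {B I : Set} → (I → Subset B) → Subset B
⋃ {B} {I} X b = Σ I λ i → X i b

⋂ : ∀ {B I : Set} → (I → Subset B) → Subset B
⋂ {B} {I} X b = ∀ i → X i b

-- W contains a complete sublattice (closed under arbitrary nonempty unions and
-- intersections in the power set of A) isomorphic to the lattice of all subsets
-- of ω = ℕ.  This is witnessed by a map f : 𝒫(ω) → W that is an order
-- embedding and preserves all nonempty unions and intersections; its image
-- { u | ∃ X. f X ≐ u } is then such a sublattice and f is an isomorphism onto it.
record PowersetOfωEmbeds {A : Set} (W : Family A) : Set₂ where
  field
    f        : Subset ℕ → Subset A
    f∈W      : ∀ X → W (f X)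
    monotone : ∀ X Y → X ⊆ Y → f X ⊆ f Y
    reflects : ∀ X Y → f X ⊆ f Y → X ⊆ Y
    pres-⋃   : (I : Set) → I → (X : I → Subset ℕ) → f (⋃ X) ≐ ⋃ (λ i → f (X i))
    pres-⋂   : (I : Set) → I → (X : I → Subset ℕ) → f (⋂ X) ≐ ⋂ (λ i → f (X i))

CardinalityAtLeastContinuum : ∀ {A : Set} → Family A → Set₁
CardinalityAtLeastContinuum {A} W =
  Σ ((ℕ → Bool) → Subset A) λ g →
    (∀ x → W (g x)) × (∀ x y → g x ≐ g y → ∀ n → x n ≡ y n)

{-# OPTIONS --safe #-}

-- Since W is generated by the s m and is T₁, for distinct points a and b some
-- s m contains a but not b.  Fix a point a.  By freeness, infinitely many s m
-- contain a and infinitely many do not.  Let P n be the union of the s m, over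
-- m < bound n, that omit a, and Q n the intersection of those that contain a,
-- where bound grows fast enough to make both sequences strict.
-- For b ≠ a let i be the least n with b ∈ P (n + 1), and j the least n with
-- b ∉ Q (n + 1).  Then j is finite, and
--   f X = { b ≠ a | i < j, or i = j ∈ X }
-- is the diagonal of the relation "some n has i, i' ≤ n < j, j', or n ∈ X and
-- i, i' ≤ n ≤ j, j'", whose rows and columns are finite unions of sets
-- P (n + 1) ∩ Q m.  The sets { i = j = n } are nonempty and disjoint.

module Submission where

open import Defs
open import Level using (0ℓ)
open import Data.Nat using (ℕ; zero; suc; _≤_; _<_; _⊔_; z≤n; s≤s)
open import Data.Nat.Properties using (≤-refl; ≤-trans; ≤-antisym; <-trans; <-≤-trans; <-cmp; <-irrefl; <⇒≤; ≮⇒≥; ≰⇒>; <⇒≱; n<1+n; m≤n⇒m≤1+n; m≤m⊔n; m≤n⊔m; m<1+n⇒m<n∨m≡n; m≤n⇒m<n∨m≡n)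
open import Data.Bool using (true; false; T)
open import Data.Empty using (⊥-elim)
open import Data.Unit using (⊤; tt)
open import Data.Product using (Σ; _×_; _,_; proj₁; proj₂; swap)
open import Data.Sum using (_⊎_; inj₁; inj₂; [_,_]′)
import Data.Sum as Sum
import Data.Product as Prod
open import Function using (_∘_; id)
open import Relation.Nullary using (¬_; yes; no)
open import Relation.Nullary.Decidable using (decidable-stable)
open import Relation.Binary.Definitions using (tri<; tri≈; tri>)
open import Relation.Binary.PropositionalEquality as ≡ using (_≡_; subst)
open import Axiom.ExcludedMiddle using (ExcludedMiddle)

-- Distributive lattice identities in power sets.

⟦⟧-sound : ∀ {A : Set} {t u} (s : ℕ → Subset A) → t ≈ u → ⟦ t ⟧ s ≐ ⟦ u ⟧ s
⟦⟧-sound s refl = (λ _ → id) , (λ _ → id)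
⟦⟧-sound s (sym e) = swap (⟦⟧-sound s e)
⟦⟧-sound s (trans e e') =
  let (f , g) = ⟦⟧-sound s e ; (f' , g') = ⟦⟧-sound s e'
  in (λ a → f' a ∘ f a) , (λ a → g a ∘ g' a)
⟦⟧-sound s (∨-cong e e') =
  let (f , g) = ⟦⟧-sound s e ; (f' , g') = ⟦⟧-sound s e'
  in (λ a → Sum.map (f a) (f' a)) , (λ a → Sum.map (g a) (g' a))
⟦⟧-sound s (∧-cong e e') =
  let (f , g) = ⟦⟧-sound s e ; (f' , g') = ⟦⟧-sound s e'
  in (λ a → Prod.map (f a) (f' a)) , (λ a → Prod.map (g a) (g' a))
⟦⟧-sound s (∨-assoc _ _ _) = (λ _ → Sum.assocʳ) , (λ _ → Sum.assocˡ)
⟦⟧-sound s (∧-assoc _ _ _) = (λ _ → Prod.assocʳ) , (λ _ → Prod.assocˡ)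
⟦⟧-sound s (∨-comm _ _) = (λ _ → Sum.swap) , (λ _ → Sum.swap)
⟦⟧-sound s (∧-comm _ _) = (λ _ → swap) , (λ _ → swap)
⟦⟧-sound s (∨-absorbs-∧ _ _) = (λ _ → [ id , proj₁ ]′) , (λ _ → inj₁)
⟦⟧-sound s (∧-absorbs-∨ _ _) = (λ _ → proj₁) , (λ _ x → x , inj₁ x)
⟦⟧-sound s (∧-distrib-∨ _ _ _) =
  (λ _ (x , yz) → Sum.map (x ,_) (x ,_) yz) ,
  (λ _ → [ Prod.map₂ inj₁ , Prod.map₂ inj₂ ]′)

module _ (em : ExcludedMiddle 0ℓ) where

  ¬∀⇒∃¬ : {A : Set} {K L : A → Set} → ¬ (∀ x → K x → L x) → Σ A λ x → K x × ¬ L x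
  ¬∀⇒∃¬ h = decidable-stable em λ ∄ →
    h λ x k → decidable-stable em λ ¬l → ∄ (x , k , ¬l)

  -- Finite unions and intersections in a Pratt comonoid.

  module Closure {A : Set} {W : Family A} (pratt : IsPrattComonoid W) where
    open IsPrattComonoid pratt

    ×-const∈ : (K : Set) {u : Subset A} → W u → W (λ b → K × u b)
    ×-const∈ K wu with em {K}
    ... | yes k = extensional _ _ ((λ _ → k ,_) , (λ _ → proj₂)) wu
    ... | no ¬k = extensional _ _ ((λ _ ()) , (λ _ → ¬k ∘ proj₁)) empty∈

    ⊎-const∈ : (K : Set) {u : Subset A} → W u → W (λ b → K ⊎ u b)
    ⊎-const∈ K wu with em {K}
    ... | yes k = extensional _ _ ((λ _ _ → inj₁ k) , (λ _ _ → tt)) full∈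
    ... | no ¬k = extensional _ _ ((λ _ → inj₂) , (λ _ → [ ⊥-elim ∘ ¬k , id ]′)) wu

    →-const∈ : (K : Set) {u : Subset A} → W u → W (λ b → K → u b)
    →-const∈ K wu with em {K}
    ... | yes k = extensional _ _ ((λ _ x _ → x) , (λ _ f → f k)) wu
    ... | no ¬k = extensional _ _ ((λ _ _ → ⊥-elim ∘ ¬k) , (λ _ _ → tt)) full∈

    -- Diagonal of the rectangle with sides `u` and `v`: by excluded middle each row is `v` or
    -- empty, each column `u` or empty.
    ∩∈ : {u v : Subset A} → W u → W v → W (λ b → u b × v b)
    ∩∈ {u} {v} wu wv = diagonal (λ a b → u a × v b)
      (λ a → ×-const∈ (u a) wv)
      (λ a → extensional _ _ ((λ _ → swap) , (λ _ → swap)) (×-const∈ (v a) wu))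

    ∪∈ : {u v : Subset A} → W u → W v → W (λ b → u b ⊎ v b)
    ∪∈ {u} {v} wu wv = diagonal (λ a b → u a ⊎ v b)
      (λ a → ⊎-const∈ (u a) wv)
      (λ a → extensional _ _ ((λ _ → Sum.swap) , (λ _ → Sum.swap)) (⊎-const∈ (v a) wu))

    bounded-⋃∈ : {w : ℕ → Subset A} → (∀ n → W (w n)) →
                 ∀ N → W (λ b → Σ ℕ λ n → n < N × w n b)
    bounded-⋃∈ w∈ zero = extensional _ _ ((λ _ ()) , (λ { _ (_ , () , _) })) empty∈
    bounded-⋃∈ w∈ (suc N) = extensional _ _
      ((λ _ → [ (λ (n , n<N , x) → n , m≤n⇒m≤1+n n<N , x) , (λ x → N , ≤-refl , x) ]′) ,
       (λ _ (n , n<1+N , x) → [ (λ n<N → inj₁ (n , n<N , x)) , (λ { ≡.refl → inj₂ x }) ]′ (m<1+n⇒m<n∨m≡n n<1+N)))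
      (∪∈ (bounded-⋃∈ w∈ N) (w∈ N))

    bounded-⋂∈ : {w : ℕ → Subset A} → (∀ n → W (w n)) →
                 ∀ N → W (λ b → ∀ n → n < N → w n b)
    bounded-⋂∈ w∈ zero = extensional _ _ ((λ { _ _ _ () }) , (λ _ _ → tt)) full∈
    bounded-⋂∈ w∈ (suc N) = extensional _ _
      ((λ _ (x , y) n n<1+N → [ x n , (λ { ≡.refl → y }) ]′ (m<1+n⇒m<n∨m≡n n<1+N)) ,
       (λ _ x → (λ n n<N → x n (m≤n⇒m≤1+n n<N)) , x N ≤-refl))
      (∩∈ (bounded-⋂∈ w∈ N) (w∈ N))

  -- Realizing finite membership patterns by points.

  -- Terms cannot be empty meets or joins, hence the extra variables N and suc N,
  -- which are fresh when M ≤ N.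
  meet : (K : Subset ℕ) (N M : ℕ) → Term
  meet K N zero = var N
  meet K N (suc M) with em {K M}
  ... | yes _ = var M ∧ meet K N M
  ... | no _  = meet K N M

  join : (K : Subset ℕ) (N M : ℕ) → Term
  join K N zero = var (suc N)
  join K N (suc M) with em {K M}
  ... | yes _ = join K N M
  ... | no _  = var M ∨ join K N M

  module _ {A : Set} (s : ℕ → Subset A) (K : Subset ℕ) (N : ℕ) where

    meet-elim : ∀ M {b} → ⟦ meet K N M ⟧ s b → ∀ m → m < M → K m → s m b
    meet-elim (suc M) x m m<1+M k with em {K M} | m<1+n⇒m<n∨m≡n m<1+M
    ... | yes _ | inj₁ m<M = meet-elim M (proj₂ x) m m<M k
    ... | yes _ | inj₂ ≡.refl = proj₁ x
    ... | no _ | inj₁ m<M = meet-elim M x m m<M k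
    ... | no ¬k | inj₂ ≡.refl = ⊥-elim (¬k k)

    meet-intro : ∀ M {b} → s N b → (∀ m → m < M → K m → s m b) → ⟦ meet K N M ⟧ s b
    meet-intro zero x _ = x
    meet-intro (suc M) x h with em {K M}
    ... | yes k = h M ≤-refl k , meet-intro M x (λ m m<M → h m (m≤n⇒m≤1+n m<M))
    ... | no _ = meet-intro M x (λ m m<M → h m (m≤n⇒m≤1+n m<M))

    join-intro : ∀ M {b m} → m < M → ¬ K m → s m b → ⟦ join K N M ⟧ s b
    join-intro (suc M) m<1+M ¬k x with em {K M} | m<1+n⇒m<n∨m≡n m<1+M
    ... | yes _ | inj₁ m<M = join-intro M m<M ¬k x
    ... | yes k | inj₂ ≡.refl = ⊥-elim (¬k k)
    ... | no _ | inj₁ m<M = inj₂ (join-intro M m<M ¬k x)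
    ... | no _ | inj₂ ≡.refl = inj₁ x

    join-elim : ∀ M {b} → ⟦ join K N M ⟧ s b →
                s (suc N) b ⊎ Σ ℕ λ m → m < M × ¬ K m × s m b
    join-elim zero x = inj₁ x
    join-elim (suc M) x with em {K M}
    ... | yes _ = Sum.map₂ (λ (m , m<M , r) → m , m≤n⇒m≤1+n m<M , r) (join-elim M x)
    join-elim (suc M) (inj₁ x) | no ¬k = inj₂ (M , ≤-refl , ¬k , x)
    join-elim (suc M) (inj₂ x) | no _ =
      Sum.map₂ (λ (m , m<M , r) → m , m≤n⇒m≤1+n m<M , r) (join-elim M x)

  AgreesBelow : {A : Set} → (ℕ → Subset A) → Subset ℕ → ℕ → Subset A
  AgreesBelow s K N b = ∀ m → m < N → (K m → s m b) × (s m b → K m)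

  abstract

    -- It suffices to find a point in the meet of the `s m` with `m` in `K` but outside the join of
    -- the others. If there were none, freeness would make "meet below join" a law of distributive
    -- lattices, and it fails in the two-element lattice.
    free⇒dense : {A : Set} {s : ℕ → Subset A} → FreeGenerators s →
                 ∀ K N → Σ A (AgreesBelow s K N)
    free⇒dense {A} {s} free K N = Prod.map₂ agrees (¬∀⇒∃¬ meet⊈join)
      where
      -- Subsets of a point form the two-element lattice. The extra variable of the meet is sent to
      -- top, that of the join to bottom.
      ρ : ℕ → Subset ⊤
      ρ m _ = (m < N × K m) ⊎ m ≡ N

      ρ-join : ¬ ⟦ join K N N ⟧ ρ tt
      ρ-join x with join-elim ρ K N N x
      ... | inj₁ (inj₁ (1+N<N , _)) = <-irrefl ≡.refl (<-trans (n<1+n N) 1+N<N)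
      ... | inj₁ (inj₂ ())
      ... | inj₂ (_ , _ , ¬k , inj₁ (_ , k)) = ¬k k
      ... | inj₂ (_ , m<N , _ , inj₂ m≡N) = <-irrefl m≡N m<N

      meet⊈join : ¬ (⟦ meet K N N ⟧ s ⊆ ⟦ join K N N ⟧ s)
      meet⊈join h =
        ρ-join (proj₁ (proj₂ (⟦⟧-sound ρ (free (join K N N ∧ meet K N N) (meet K N N)
          ((λ _ → proj₂) , (λ b x → h b x , x)))) tt
          (meet-intro ρ K N N (inj₂ ≡.refl) (λ m m<N k → inj₁ (m<N , k)))))

      agrees : ∀ {b} → ⟦ meet K N N ⟧ s b × ¬ ⟦ join K N N ⟧ s b → AgreesBelow s K N b
      agrees {b} (x , ¬y) m m<N = meet-elim s K N N x m m<N , K-holds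
        where
        K-holds : s m b → K m
        K-holds y = decidable-stable em λ ¬k → ¬y (join-intro s K N N m<N ¬k y)

  -- Separation of points by generators.

  -- The sets that contain `b` if they contain `a` form a Pratt structure: `C a a` gives `C a b` by
  -- row `a`, then `C b b` by column `b`. If no generator separated `a` from `b`, minimality would
  -- put all of `W` in it, against T₁.
  T₁⇒antichain : {A : Set} {W : Family A} {s : ℕ → Subset A} →
                 IsLeastPrattContaining W (Range s) → IsT₁ W →
                 ∀ a b → ¬ a ≡ b → Σ ℕ λ m → s m a × ¬ s m b
  T₁⇒antichain {A} {W} {s} leastW t₁ a b a≢b = ¬∀⇒∃¬ λ h →
    let (w , w∈ , wa , ¬wb) = t₁ a b a≢b
    in ¬wb (least W′ isPratt′ (λ u (i , (f , g)) → f b ∘ h i ∘ g a) w w∈ wa)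
    where
    open IsLeastPrattContaining leastW

    W′ : Family A
    W′ u = u a → u b

    isPratt′ : IsPrattComonoid W′
    isPratt′ = record
      { extensional = λ _ _ (f , g) h → f b ∘ h ∘ g a
      ; empty∈ = id
      ; full∈ = id
      ; diagonal = λ C rows columns → columns b ∘ rows a
      }

  module Construction {A : Set} {W : Family A} {s : ℕ → Subset A}
    (free : FreeGenerators s) (leastW : IsLeastPrattContaining W (Range s)) (t₁ : IsT₁ W) where

    open IsLeastPrattContaining leastW
    open IsPrattComonoid isPratt
    open Closure isPratt

    abstract

      antichain : ∀ a b → ¬ a ≡ b → Σ ℕ λ m → s m a × ¬ s m b
      antichain = T₁⇒antichain leastW t₁

    -- Generators containing and omitting a base point.

    a : A
    a = proj₁ (free⇒dense free (λ _ → ⊤) 0)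

    flipFrom : ℕ → Subset ℕ
    flipFrom n m = (m < n × s m a) ⊎ (n ≤ m × ¬ s m a)

    abstract

      -- Otherwise flipping the n-th bit of a gives a point comparable to a.
      later-out : ∀ n → Σ ℕ λ m → n ≤ m × ¬ s m a
      later-out n = ¬∀⇒∃¬ λ all-in →
        let (b , agrees) = free⇒dense free (flipFrom n) (suc n)
            b∌n : ¬ s n b
            b∌n = [ <-irrefl ≡.refl ∘ proj₁ , (λ (_ , ¬x) → ¬x (all-in n ≤-refl)) ]′ ∘ proj₂ (agrees n ≤-refl)
            (m , mb , ¬ma) = antichain b a (λ b≡a → b∌n (subst (s n) (≡.sym b≡a) (all-in n ≤-refl)))
            m<n = ≰⇒> (¬ma ∘ all-in m)
        in [ ¬ma ∘ proj₂ , (λ (n≤m , _) → <⇒≱ m<n n≤m) ]′ (proj₂ (agrees m (m≤n⇒m≤1+n m<n)) mb)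

      later-in : ∀ n → Σ ℕ λ m → n ≤ m × s m a
      later-in n = decidable-stable em λ all-out →
        let (b , agrees) = free⇒dense free (flipFrom n) (suc n)
            a∌n : ¬ s n a
            a∌n x = all-out (n , ≤-refl , x)
            b∋n = proj₁ (agrees n ≤-refl) (inj₂ (≤-refl , a∌n))
            (m , ma , ¬mb) = antichain a b (λ a≡b → a∌n (subst (s n) (≡.sym a≡b) b∋n))
            m<n = ≰⇒> (λ n≤m → all-out (m , n≤m , ma))
        in ¬mb (proj₁ (agrees m (m≤n⇒m≤1+n m<n)) (inj₁ (m<n , ma)))

    abstract

      bound : ℕ → ℕ
      bound zero = 0
      bound (suc n) = suc (proj₁ (later-out (bound n)) ⊔ proj₁ (later-in (bound n)))

      bound-out : ∀ n → Σ ℕ λ m → bound n ≤ m × m < bound (suc n) × ¬ s m a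
      bound-out n = let (m , le , out) = later-out (bound n) in m , le , s≤s (m≤m⊔n _ _) , out

      bound-in : ∀ n → Σ ℕ λ m → bound n ≤ m × m < bound (suc n) × s m a
      bound-in n = let (m , le , x) = later-in (bound n) in m , le , s≤s (m≤n⊔m (proj₁ (later-out (bound n))) _) , x

    bound-step : ∀ n → bound n < bound (suc n)
    bound-step n = let (_ , le , lt , _) = bound-out n in ≤-trans (s≤s le) lt

    n≤bound : ∀ n → n ≤ bound n
    n≤bound zero = z≤n
    n≤bound (suc n) = ≤-trans (s≤s (n≤bound n)) (bound-step n)

    bound-mono : ∀ {m n} → m ≤ n → bound m ≤ bound n
    bound-mono {n = zero} z≤n = ≤-refl
    bound-mono {n = suc n} m≤1+n with m≤n⇒m<n∨m≡n m≤1+n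
    ... | inj₁ (s≤s m≤n) = ≤-trans (bound-mono m≤n) (<⇒≤ (bound-step n))
    ... | inj₂ ≡.refl = ≤-refl

    -- The two monotone sequences in `W`.

    P Q : ℕ → Subset A
    P n b = Σ ℕ λ m → m < bound n × ¬ s m a × s m b
    Q n b = ∀ m → m < bound n → s m a → s m b

    P-mono : ∀ {m n b} → m ≤ n → P m b → P n b
    P-mono m≤n (k , k<m , x) = k , <-≤-trans k<m (bound-mono m≤n) , x

    Q-antitone : ∀ {m n b} → m ≤ n → Q n b → Q m b
    Q-antitone m≤n q k k<m = q k (<-≤-trans k<m (bound-mono m≤n))

    s∈ : ∀ m → W (s m)
    s∈ m = contains (s m) (m , (λ _ → id) , (λ _ → id))

    P∈ : ∀ n → W (P n)
    P∈ n = bounded-⋃∈ (λ m → ×-const∈ (¬ s m a) (s∈ m)) (bound n)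

    Q∈ : ∀ n → W (Q n)
    Q∈ n = bounded-⋂∈ (λ m → →-const∈ (s m a) (s∈ m)) (bound n)

    -- Some `s m` contains `b` but not `a`, so the two points differ and some `s l` contains `a` but
    -- not `b`. This excludes `b` from `Q k` once `l < bound k`. The cutoff `N` is what makes the
    -- rows below finite unions.
    P⇒Q-bounded : ∀ {n b} → P n b → Σ ℕ λ N → ∀ k → Q k b → k < N
    P⇒Q-bounded {n} {b} (m , _ , ¬ma , mb) =
      let (l , la , ¬lb) = antichain a b (λ a≡b → ¬ma (subst (s m) (≡.sym a≡b) mb))
      in suc l , λ k q → ≰⇒> λ l<k → ¬lb (q l (<-≤-trans l<k (n≤bound k)) la)

    -- The point copies `a` below `bound n` and opposes it from there up to `bound (suc n)`, so it
    -- enters `P` and leaves `Q` at the same stage: i = j = n.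
    spot : ∀ n → Σ A λ b → P (suc n) b × Q n b × ¬ P n b × ¬ Q (suc n) b
    spot n =
      let (b , agrees) = free⇒dense free (flipFrom (bound n)) (bound (suc n))
          (i , ≤i , i< , i-out) = bound-out n
          (j , ≤j , j< , j-in) = bound-in n
      in b ,
         (i , i< , i-out , proj₁ (agrees i i<) (inj₂ (≤i , i-out))) ,
         (λ m m<n ma → proj₁ (agrees m (<-trans m<n (bound-step n))) (inj₁ (m<n , ma))) ,
         (λ (m , m<n , ¬ma , mb) →
           [ ¬ma ∘ proj₂ , (λ (n≤m , _) → <⇒≱ m<n n≤m) ]′ (proj₂ (agrees m (<-trans m<n (bound-step n))) mb)) ,
         (λ q → [ (λ (j<n , _) → <⇒≱ j<n ≤j) , (λ (_ , ¬x) → ¬x j-in) ]′ (proj₂ (agrees j j<) (q j j< j-in)))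

    -- The embedding of the power set of ω.

    -- In terms of the i and j of `b`, `P (suc n) b` means i ≤ n, `Q (suc n) b` means n < j, and
    -- `Q n b` means n ≤ j. The first alternative thus amounts to i < j; the second adds only the
    -- case i = j = n.
    f : Subset ℕ → Subset A
    f X b = Σ ℕ λ n → P (suc n) b × (Q (suc n) b ⊎ (X n × Q n b))

    f∈W : ∀ X → W (f X)
    f∈W X = extensional _ _
      ((λ _ (n , (p , _) , q) → n , p , Sum.map proj₁ (Prod.map₂ proj₁) q) ,
       (λ _ (n , p , q) → n , (p , p) , Sum.map (λ x → x , x) (Prod.map₂ (λ x → x , x)) q))
      (diagonal C row∈ (λ b → extensional _ _ (C-sym b) (row∈ b)))
      where
      C : A → A → Set
      C b c = Σ ℕ λ n → (P (suc n) b × P (suc n) c) ×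
                        ((Q (suc n) b × Q (suc n) c) ⊎ (X n × Q n b × Q n c))

      C-flip : ∀ {b c} → C b c → C c b
      C-flip (n , p , q) = n , swap p , Sum.map swap (Prod.map₂ swap) q

      C-sym : ∀ b → (λ c → C b c) ≐ (λ c → C c b)
      C-sym b = (λ _ → C-flip) , (λ _ → C-flip)

      cell∈ : ∀ b n → W (λ c → (P (suc n) b × P (suc n) c) ×
                               ((Q (suc n) b × Q (suc n) c) ⊎ (X n × Q n b × Q n c)))
      cell∈ b n = ∩∈ (×-const∈ (P (suc n) b) (P∈ (suc n)))
        (∪∈ (×-const∈ (Q (suc n) b) (Q∈ (suc n))) (×-const∈ (X n) (×-const∈ (Q n b) (Q∈ n))))

      row∈ : ∀ b → W (C b)
      row∈ b with em {Σ ℕ λ n → P n b}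
      -- This case covers `a` itself, which lies in every `Q n` and so admits no cutoff.
      ... | no ∉P = extensional _ _ ((λ _ ()) , (λ _ (n , (p , _) , _) → ∉P (suc n , p))) empty∈
      ... | yes (k , p) with P⇒Q-bounded {k} p
      ...   | N , Q-bounded = extensional _ _
        ((λ _ (n , _ , x) → n , x) ,
         (λ _ (n , x) → n , Q-bounded n (Qn (proj₂ x)) , x))
        (bounded-⋃∈ (cell∈ b) N)
        where
        Qn : ∀ {n c} → (Q (suc n) b × Q (suc n) c) ⊎ (X n × Q n b × Q n c) → Q n b
        Qn = [ Q-antitone (<⇒≤ (n<1+n _)) ∘ proj₁ , proj₁ ∘ proj₂ ]′

    f-monotone : ∀ X Y → X ⊆ Y → f X ⊆ f Y
    f-monotone X Y X⊆Y b (n , p , q) = n , p , Sum.map₂ (Prod.map₁ (X⊆Y n)) q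

    -- At `spot n`, where i = j = n, any `k` that witnesses membership in `f Y` must equal `n`, and
    -- the alternative with `Q (suc k)` is impossible.
    f-reflects : ∀ X Y → f X ⊆ f Y → X ⊆ Y
    f-reflects X Y fX⊆fY n Xn with spot n
    ... | b , p , q , ¬p , ¬q with fX⊆fY b (n , p , inj₂ (Xn , q))
    ...   | k , pk , qk = conclude qk
      where
      n≤k : n ≤ k
      n≤k = ≮⇒≥ λ k<n → ¬p (P-mono k<n pk)

      Q⇒≤n : ∀ {l} → Q l b → l ≤ n
      Q⇒≤n ql = ≮⇒≥ λ n<l → ¬q (Q-antitone n<l ql)

      conclude : Q (suc k) b ⊎ (Y k × Q k b) → Y n
      conclude (inj₁ q′) = ⊥-elim (<⇒≱ (Q⇒≤n q′) n≤k)
      conclude (inj₂ (Yk , q′)) = subst Y (≤-antisym (Q⇒≤n q′) n≤k) Yk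

    f-pres-⋃ : (I : Set) → I → (X : I → Subset ℕ) → f (⋃ X) ≐ ⋃ (λ i → f (X i))
    f-pres-⋃ I i₀ X = to , λ b (i , x) → f-monotone (X i) (⋃ X) (λ _ → i ,_) b x
      where
      to : f (⋃ X) ⊆ ⋃ (λ i → f (X i))
      -- Points with i < j lie in every `f X`, so any member of the family serves; hence the need
      -- for `i₀`.
      to b (n , p , inj₁ q) = i₀ , n , p , inj₁ q
      to b (n , p , inj₂ ((i , x) , q)) = i , n , p , inj₂ (x , q)

    f-pres-⋂ : (I : Set) → I → (X : I → Subset ℕ) → f (⋂ X) ≐ ⋂ (λ i → f (X i))
    f-pres-⋂ I i₀ X = (λ b x i → f-monotone (⋂ X) (X i) (λ _ y → y i) b x) , from
      where
      from : ⋂ (λ i → f (X i)) ⊆ f (⋂ X)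
      from b x with em {Σ ℕ λ n → P (suc n) b × Q (suc n) b}
      ... | yes (n , p , q) = n , p , inj₁ q
      -- Here i < j fails, so all members of the family are witnessed at the same `n`: distinct
      -- witnesses k < n would give both `P (suc k) b` and `Q (suc k) b`.
      ... | no i≮j = let (n , p , _ , q) = diag i₀ in n , p , inj₂ ((λ i → transport (diag i) p q) , q)
        where
        diag : ∀ i → Σ ℕ λ n → P (suc n) b × X i n × Q n b
        diag i with x i
        ... | n , p , inj₁ q = ⊥-elim (i≮j (n , p , q))
        ... | n , p , inj₂ (y , q) = n , p , y , q

        transport : ∀ {i n} → (Σ ℕ λ n → P (suc n) b × X i n × Q n b) → P (suc n) b → Q n b → X i n
        transport {n = n} (k , pk , y , qk) p q with <-cmp k n
        ... | tri< k<n _ _ = ⊥-elim (i≮j (k , pk , Q-antitone k<n q))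
        ... | tri≈ _ ≡.refl _ = y
        ... | tri> _ _ n<k = ⊥-elim (i≮j (n , p , Q-antitone n<k qk))

    powerset-embeds : PowersetOfωEmbeds W
    powerset-embeds = record
      { f = f
      ; f∈W = f∈W
      ; monotone = f-monotone
      ; reflects = f-reflects
      ; pres-⋃ = f-pres-⋃
      ; pres-⋂ = f-pres-⋂
      }

-- The cardinality bound, with Boolean sequences as subsets of ω.

T-injective : ∀ {x y} → (T x → T y) → (T y → T x) → x ≡ y
T-injective {false} {false} _ _ = ≡.refl
T-injective {false} {true} _ g = ⊥-elim (g tt)
T-injective {true} {false} f _ = ⊥-elim (f tt)
T-injective {true} {true} _ _ = ≡.refl

powerset⇒continuum : {A : Set} {W : Family A} → PowersetOfωEmbeds W → CardinalityAtLeastContinuum W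
powerset⇒continuum e =
  (λ x → f (T ∘ x)) , (λ x → f∈W (T ∘ x)) ,
  λ x y (x⊆y , y⊆x) n → T-injective (reflects _ _ x⊆y n) (reflects _ _ y⊆x n)
  where open PowersetOfωEmbeds e

theorem7p4 : ExcludedMiddle 0ℓ → ExcludedMiddle (Level.suc 0ℓ) →
    (A : Set) (W : Family A) (s : ℕ → Subset A) →
    FreeGenerators s →
    IsLeastPrattContaining W (Range s) →
    IsT₁ W →
    CardinalityAtLeastContinuum W × PowersetOfωEmbeds W
theorem7p4 em _ A W s free leastW t₁ = powerset⇒continuum embeds , embeds
  where
  embeds : PowersetOfωEmbeds W
  embeds = Construction.powerset-embeds em free leastW t₁
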